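{- For every positive integer $n$, \[\max_{\pi\in S_n}|\operatorname{SC}_{132}^{ -1}(\pi)|=\max_{\pi\in S_n}|\operatorname{SC}_{312}^{ -1}(\pi)|=\binom{n-1}{\lfloor (n-1)/2\rfloor}.\]
   Context: $S_n$ is the set of permutations of $[n]$ in one-line notation. Two sequences of distinct integers have the same relative order if replacing the $i$th smallest entry of each by $i$ yields the same word; a sequence avoids $\sigma$ consecutively if no consecutive subsequence has the same relative order as $\sigma$. For $\sigma\in\{132,312\}$, $\operatorname{SC}_\sigma:S_n\to S_n$ sends a permutation through a stack: at each step, if there is a next input entry and placing it on top of the stack would make the stack contents, read top to bottom, avoid $\sigma$ consecutively, push it; otherwise pop the top entry of the stack to the end of the output; stop when the output has length $n$. -}

module Defs where

open import Data.Bool using (Bool; true; false; _∧_; _∨_; not; if_then_else_)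
open import Data.Bool.Properties using () renaming (_≟_ to _≟ᵇ_)
open import Data.Nat using (ℕ; zero; suc; _<ᵇ_; _≡ᵇ_; _⊔_)
open import Data.List using (List; []; _∷_; map; concatMap; upTo; length; filterᵇ; foldr)
open import Data.Bool.ListAction using (any)
open import Data.Product using (_×_; _,_)

_==_ : Bool → Bool → Bool
true == b = b
false == b = not b

-- Two triples of distinct integers have the same relative order
-- (standardizing both gives the same word), tested pairwise.
Triple : Set
Triple = ℕ × ℕ × ℕ

sameOrder : Triple → Triple → Bool
sameOrder (a , b , c) (p , q , r) =
  ((a <ᵇ b) == (p <ᵇ q)) ∧ ((a <ᵇ c) == (p <ᵇ r)) ∧ ((b <ᵇ c) == (q <ᵇ r))

pat132 : Triple
pat132 = (1 , 3 , 2)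

pat312 : Triple
pat312 = (3 , 1 , 2)

containsConsec : Triple → List ℕ → Bool
containsConsec σ (a ∷ b ∷ c ∷ rest) =
  sameOrder (a , b , c) σ ∨ containsConsec σ (b ∷ c ∷ rest)
containsConsec σ _ = false

avoidsConsec : Triple → List ℕ → Bool
avoidsConsec σ w = not (containsConsec σ w)

-- The σ-stack machine. Arguments: remaining input, stack (head = top).
-- Result: the remaining output produced from this state.
-- When the stack is empty, pushing is always allowed (a one-entry stack
-- avoids any length-3 pattern) and there is nothing to pop.
-- When the input is exhausted, the stack is popped top to bottom.
run : Triple → List ℕ → List ℕ → List ℕ
run σ [] st = st
run σ (x ∷ xs) [] = run σ xs (x ∷ [])
run σ (x ∷ xs) (s ∷ st) =
  if avoidsConsec σ (x ∷ s ∷ st)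
  then run σ xs (x ∷ s ∷ st)
  else s ∷ run σ (x ∷ xs) st

SC : Triple → List ℕ → List ℕ
SC σ π = run σ π []

eqList : List ℕ → List ℕ → Bool
eqList [] [] = true
eqList (x ∷ xs) (y ∷ ys) = (x ≡ᵇ y) ∧ eqList xs ys
eqList _ _ = false

range : ℕ → List ℕ
range n = map suc (upTo n)

words : ℕ → ℕ → List (List ℕ)
words n zero = [] ∷ []
words n (suc k) = concatMap (λ i → map (i ∷_) (words n k)) (range n)

elemᵇ : ℕ → List ℕ → Bool
elemᵇ x = any (x ≡ᵇ_)

distinct : List ℕ → Bool
distinct [] = true
distinct (x ∷ xs) = not (elemᵇ x xs) ∧ distinct xs

S : ℕ → List (List ℕ)
S n = filterᵇ distinct (words n n)

preimageCount : Triple → ℕ → List ℕ → ℕ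
preimageCount σ n π = length (filterᵇ (λ τ → eqList (SC σ τ) π) (S n))

maxPreimage : Triple → ℕ → ℕ
maxPreimage σ n = foldr _⊔_ 0 (map (preimageCount σ n) (S n))

{-# OPTIONS --safe #-}

-- Write x ≺ y for x < y when σ = 312 and for x ≥ y when σ = 132; then in
-- both cases x pops the top s, lying over t, iff x ⊀ s, x ⊀ t and s ≺ t.  Once x is
-- pushed on s with x ⊀ s, neither is popped before the input is exhausted.  Hence if
-- the stack T must survive and the remaining output is p₀ … pₘ₋₁ T, the remaining
-- input is pⱼ₋₁ … p₀ pₘ₋₁ r for some j ≥ 0: the entries p₀ ≺ … ≺ pⱼ₋₁ are pushed on T
-- and then all popped by pₘ₋₁.  So a preimage is a way of consuming the ascent/descent
-- word of π from both ends: a letter taken on the right is an entry that stays, a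
-- letter taken on the left an entry popped early, and the latter is possible only
-- against a right-hand descent.  If the letter on the left is itself a descent, it
-- cannot share its right-hand descent with the next popped entry, so both go at once.
--
-- Among words of length m the count is largest for an ascending block followed by a
-- descending one.  While the descents outnumber the leading ascents, turning
-- the first descent into an ascent does not decrease the count; once they do not,
-- Pascal's rule bounds the count by a binomial coefficient.  Equality holds for
-- π = a₁ … aₖ b_d … b₀ with a₁ ≺ … ≺ aₖ ≺ b₀ ≺ … ≺ b_d and k = ⌊(n-1)/2⌋.

module Submission where

open import Defs
open import Data.Bool using (Bool; true; false; if_then_else_; _∨_; _∧_; not)
open import Data.Bool.Properties using (∧-zeroʳ; ∨-identityʳ; T-≡; T?)
open import Data.Empty using (⊥-elim)
open import Data.List using
  ( List; []; _∷_; _++_; _ʳ++_; [_]; _∷ʳ_; map; length; applyUpTo; upTo; downFrom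
  ; take; drop; reverse; filterᵇ; foldr; concatMap; cartesianProductWith)
open import Data.List.Membership.Propositional using (_∈_)
open import Data.List.Membership.Propositional.Properties using
  ( ∈-++⁺ˡ; ∈-++⁺ʳ; ∈-++⁻; ∈-map⁺; ∈-map⁻; ∈-∃++; ∈-filter⁺; ∈-filter⁻
  ; ∈-cartesianProductWith⁺; ∈-cartesianProductWith⁻)
open import Data.List.Properties using
  ( length-++; length-map; length-ʳ++; length-applyUpTo; length-upTo; length-take; length-drop
  ; take++drop≡id; map-ʳ++; reverse-applyUpTo; applyUpTo-∷ʳ; ++-assoc; ++-identityʳ
  ; ++-cancelˡ; ++-cancelʳ; ∷-injective; ∷-injectiveˡ; ∷-injectiveʳ; ∷ʳ-injective; ++-ʳ++)
open import Data.List.Relation.Binary.Permutation.Propositional using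
  (_↭_; ↭-refl; ↭-sym; ↭-trans; prep; ↭-reflexive; ↭⇒↭ₛ)
open import Data.List.Relation.Binary.Permutation.Propositional.Properties using
  (shift; ∷↭∷ʳ; ↭-reverse; ++⁺ˡ; All-resp-↭; ↭-length)
open import Data.List.Relation.Unary.All as All using (All; []; _∷_)
open import Data.List.Relation.Unary.AllPairs using (AllPairs; []; _∷_)
open import Data.List.Relation.Unary.Any using (here; there)
open import Data.List.Relation.Unary.Unique.Propositional using (Unique)
open import Data.Nat
open import Data.Nat.Combinatorics using (_C_; nCk+nC[k+1]≡[n+1]C[k+1]; nCk≡nC[n∸k]; nCn≡1)
open import Data.Nat.DivMod using (m/n*n≤m; m≡m%n+[m/n]*n; m%n<n)
open import Data.Nat.Properties
open import Data.Product using (_×_; _,_; proj₁; proj₂; ∃)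
open import Data.Sum using (_⊎_; inj₁; inj₂; [_,_]′)
open import Function using (_∘_; Equivalence)
open import Relation.Binary.PropositionalEquality hiding ([_])
open import Relation.Nullary using (¬_)
import Data.List.Relation.Binary.Permutation.Setoid.Properties as Permutation
import Data.List.Relation.Unary.All.Properties as All
import Data.List.Relation.Unary.AllPairs.Properties as AllPairs
import Data.List.Relation.Unary.Unique.Propositional.Properties as Unique

open Equivalence using (to; from)

-- Binomial coefficients

pascal : ∀ n k → suc n C suc k ≡ n C k + n C suc k
pascal n k = sym (nCk+nC[k+1]≡[n+1]C[k+1] n k)

C-suc-mono : ∀ n k → n C k ≤ suc n C k
C-suc-mono n zero    = ≤-refl
C-suc-mono n (suc k) = begin
  n C suc k            ≤⟨ m≤n+m _ _ ⟩
  n C k + n C suc k    ≡⟨ pascal n k ⟨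
  suc n C suc k        ∎
  where open ≤-Reasoning

-- If `k + suc k ≡ n` the two coefficients are mirror images; below that, Pascal's rule reduces both
-- sides to smaller instances.
C-step-up : ∀ n k → k + suc k ≤ n → n C k ≤ n C suc k
C-step-up zero    k le = ⊥-elim (1+n≰n (≤-trans (m≤n+m (suc k) k) (≤-trans le z≤n)))
C-step-up (suc n) k le with m≤n⇒m<n∨m≡n le
... | inj₂ eq = ≤-reflexive (begin
  suc n C k              ≡⟨ nCk≡nC[n∸k] (≤-trans (m≤m+n k (suc k)) le) ⟩
  suc n C (suc n ∸ k)    ≡⟨ cong (λ m → suc n C (m ∸ k)) eq ⟨
  suc n C (k + suc k ∸ k) ≡⟨ cong (suc n C_) (m+n∸m≡n k (suc k)) ⟩
  suc n C suc k          ∎)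
  where open ≡-Reasoning
C-step-up (suc n) zero    le | inj₁ (s≤s lt) =
  subst (1 ≤_) (sym (pascal n 0)) (m≤m+n 1 _)
C-step-up (suc n) (suc k) le | inj₁ (s≤s lt) = begin
  suc n C suc k                   ≡⟨ pascal n k ⟩
  n C k + n C suc k               ≤⟨ +-mono-≤ (C-step-up n k (≤-trans (+-mono-≤ (n≤1+n k) (n≤1+n (suc k))) lt)) (C-step-up n (suc k) lt) ⟩
  n C suc k + n C suc (suc k)     ≡⟨ pascal n (suc k) ⟨
  suc n C suc (suc k)             ∎
  where open ≤-Reasoning

C-mono-half : ∀ n k d → (k + d) + (k + d) ≤ n → n C k ≤ n C (k + d)
C-mono-half n k zero    le = ≤-reflexive (cong (n C_) (sym (+-identityʳ k)))
C-mono-half n k (suc d) le = ≤-trans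
  (C-mono-half n k d (≤-trans (+-mono-≤ (+-monoʳ-≤ k (n≤1+n d)) (+-monoʳ-≤ k (n≤1+n d))) le))
  (subst (λ m → n C (k + d) ≤ n C m) (sym (+-suc k d))
    (C-step-up n (k + d) (≤-trans (+-mono-≤ (+-monoʳ-≤ k (n≤1+n d)) (≤-reflexive (sym (+-suc k d)))) le)))

central : ℕ → ℕ
central n = n C (n / 2)

half+half≤ : ∀ n → n / 2 + n / 2 ≤ n
half+half≤ n = subst (_≤ n) (trans (*-comm (n / 2) 2) (cong (n / 2 +_) (+-identityʳ _))) (m/n*n≤m n 2)

≤1+half+half : ∀ n → n ≤ suc (n / 2 + n / 2)
≤1+half+half n = begin
  n                        ≡⟨ m≡m%n+[m/n]*n n 2 ⟩
  n % 2 + n / 2 * 2        ≤⟨ +-monoˡ-≤ _ (s≤s⁻¹ (m%n<n n 2)) ⟩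
  1 + n / 2 * 2            ≡⟨ cong suc (trans (*-comm (n / 2) 2) (cong (n / 2 +_) (+-identityʳ _))) ⟩
  suc (n / 2 + n / 2)      ∎
  where open ≤-Reasoning

C≤central-low : ∀ n k → k ≤ n / 2 → n C k ≤ central n
C≤central-low n k le with m≤n⇒∃[o]m+o≡n le
... | d , eq = subst (λ m → n C k ≤ n C m) eq
  (C-mono-half n k d (subst (λ m → m + m ≤ n) (sym eq) (half+half≤ n)))

-- An index above `n / 2` is reflected to `n ∸ k`, which lands in the lower half because `n` exceeds
-- twice `n / 2` by at most one.
C≤central : ∀ n k → k ≤ n → n C k ≤ central n
C≤central n k k≤n with ≤-total k (n / 2)
... | inj₁ le = C≤central-low n k le
... | inj₂ ge with m≤n⇒m<n∨m≡n ge
...   | inj₂ eq = ≤-reflexive (cong (n C_) (sym eq))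
...   | inj₁ gt = subst (_≤ central n) (sym (nCk≡nC[n∸k] k≤n))
        (C≤central-low n (n ∸ k) (m≤n+o⇒m∸n≤o n k (begin
          n                     ≤⟨ ≤1+half+half n ⟩
          suc (n / 2) + n / 2   ≤⟨ +-monoˡ-≤ _ gt ⟩
          k + n / 2             ∎)))
  where open ≤-Reasoning

-- Words consumed from both ends

-- In a word, true stands for an ascent.
Word : Set
Word = ℕ → Bool

infixr 5 _·_
_·_ : Bool → Word → Word
(b · f) zero    = b
(b · f) (suc i) = f i

anyAsc : Word → ℕ → Bool
anyAsc f zero    = false
anyAsc f (suc m) = f 0 ∨ anyAsc (f ∘ suc) m

desWeight : Bool → ℕ
desWeight b = if b then 0 else 1

des : Word → ℕ → ℕ
des f zero    = 0
des f (suc m) = desWeight (f 0) + des (f ∘ suc) m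

-- The number of ways to consume f 0 … f (m - 1) from both ends, as in the header.
-- The guard anyAsc is justified by p 0 ≺ p m, which popping p 0 requires; without it
-- the central binomial bound fails (already for m = 5).
schemes : Word → ℕ → ℕ
schemes f zero          = 0
schemes f (suc zero)    = 1
schemes f (suc (suc m)) = schemes f (suc m) +
  (if f (suc m) then 0
   else if f 0 then schemes (f ∘ suc) (suc m)
   else if anyAsc (f ∘ suc) m then schemes (f ∘ suc) m
   else 0)

anyAsc-cong : ∀ f g m → (∀ i → f i ≡ g i) → anyAsc f m ≡ anyAsc g m
anyAsc-cong f g zero    e = refl
anyAsc-cong f g (suc m) e rewrite e 0 = cong (g 0 ∨_) (anyAsc-cong _ _ m (e ∘ suc))

schemes-cong : ∀ f g m → (∀ i → f i ≡ g i) → schemes f m ≡ schemes g m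
schemes-cong f g zero e = refl
schemes-cong f g (suc zero) e = refl
schemes-cong f g (suc (suc m)) e = step
  (schemes-cong f g (suc m) e)
  (schemes-cong (f ∘ suc) (g ∘ suc) (suc m) (e ∘ suc))
  (schemes-cong (f ∘ suc) (g ∘ suc) m (e ∘ suc))
  where
  step : schemes f (suc m) ≡ schemes g (suc m) →
         schemes (f ∘ suc) (suc m) ≡ schemes (g ∘ suc) (suc m) →
         schemes (f ∘ suc) m ≡ schemes (g ∘ suc) m →
         schemes f (suc (suc m)) ≡ schemes g (suc (suc m))
  step p q r rewrite e (suc m) | e 0 | p | q | r
                   | anyAsc-cong (f ∘ suc) (g ∘ suc) m (e ∘ suc) = refl

des-snoc : ∀ f m → des f (suc m) ≡ des f m + desWeight (f m)
des-snoc f zero    = +-identityʳ _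
des-snoc f (suc m) = trans (cong (desWeight (f 0) +_) (des-snoc (f ∘ suc) m))
                           (sym (+-assoc (desWeight (f 0)) _ _))

des≤ : ∀ f m → des f m ≤ m
des≤ f zero = z≤n
des≤ f (suc m) with f 0
... | true  = m≤n⇒m≤1+n (des≤ (f ∘ suc) m)
... | false = s≤s (des≤ (f ∘ suc) m)

schemes-pos : ∀ f m → 1 ≤ schemes f (suc m)
schemes-pos f zero    = ≤-refl
schemes-pos f (suc m) = ≤-trans (schemes-pos f m) (m≤m+n _ _)

schemes-last-asc : ∀ f m → f (suc m) ≡ true → schemes f (suc (suc m)) ≡ schemes f (suc m)
schemes-last-asc f m e rewrite e = +-identityʳ _

-- The maximum over words with an ascending prefix

pad : ℕ → Word → Word
pad zero    g = g
pad (suc a) g = true · pad a g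

pad-+ : ∀ a g i → pad a g (a + i) ≡ g i
pad-+ zero    g i = refl
pad-+ (suc a) g i = pad-+ a g i

pad-cong : ∀ a f g → (∀ i → f i ≡ g i) → ∀ i → pad a f i ≡ pad a g i
pad-cong zero    f g e i       = e i
pad-cong (suc a) f g e zero    = refl
pad-cong (suc a) f g e (suc i) = pad-cong a f g e i

pad-asc : ∀ a g → g 0 ≡ true → ∀ i → pad a g i ≡ pad (suc a) (g ∘ suc) i
pad-asc zero    g e zero    = e
pad-asc zero    g e (suc i) = refl
pad-asc (suc a) g e zero    = refl
pad-asc (suc a) g e (suc i) = pad-asc a g e i

-- Keeping the leading ascents as a number turns taking one on the left into a decrement of `a`, so
-- that `Φ-last-des` is Pascal's rule in `a` and `m`.
Φ : ℕ → Word → ℕ → ℕ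
Φ a g m = schemes (pad a g) (a + m)

Φ-last-asc : ∀ a g m → g m ≡ true → Φ (suc a) g (suc m) ≡ Φ (suc a) g m
Φ-last-asc a g m e rewrite +-suc a m = schemes-last-asc _ (a + m) (trans (pad-+ a g m) e)

Φ-last-des : ∀ a g m → g m ≡ false → Φ (suc a) g (suc m) ≡ Φ (suc a) g m + Φ a g (suc m)
Φ-last-des a g m e rewrite +-suc a m | pad-+ a g m | e = refl

Φ-first-asc : ∀ a g m → g 0 ≡ true → Φ a g (suc m) ≡ Φ (suc a) (g ∘ suc) m
Φ-first-asc a g m e rewrite +-suc a m = schemes-cong _ _ (suc (a + m)) (pad-asc a g e)

Φ-first-des : ∀ a g m → g 0 ≡ false → Φ a g m ≡ Φ a (false · (g ∘ suc)) m
Φ-first-des a g m e = schemes-cong _ _ (a + m)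
  (pad-cong a _ _ λ { zero → e ; (suc i) → refl })

Φ-asc-only : ∀ a g → Φ (suc a) g 0 ≡ 1
Φ-asc-only a g rewrite +-identityʳ a = go a (pad a g) λ i lt → lem a i lt
  where
  lem : ∀ a i → i < a → pad a g i ≡ true
  lem (suc a) zero    lt       = refl
  lem (suc a) (suc i) (s≤s lt) = lem a i lt
  go : ∀ a f → (∀ i → i < a → f i ≡ true) → schemes (true · f) (suc a) ≡ 1
  go zero    f h = refl
  go (suc a) f h = trans (schemes-last-asc (true · f) a (h a ≤-refl))
                         (go a f (λ i lt → h i (m≤n⇒m≤1+n lt)))

-- The recursion of the gain of flip-ballot in a and the number of remaining descents,
-- split into the two nonnegative parts ballot a j and ballot j a.
ballot : ℕ → ℕ → ℕ
ballot zero    j       = j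
ballot (suc a) zero    = 0
ballot (suc a) (suc j) = ballot (suc a) j + ballot a (suc j)

ballot-zeroʳ : ∀ a → ballot a 0 ≡ 0
ballot-zeroʳ zero    = refl
ballot-zeroʳ (suc a) = refl

-- `ballot a j` is `(a + j) C suc a`. Both sides obey the same recursion and agree on the diagonal;
-- off it, strictness keeps both recursive calls within the hypothesis.
ballot-mono : ∀ a j → a ≤ j → ballot j a ≤ ballot a j
ballot-mono zero    j       le = subst (_≤ j) (sym (ballot-zeroʳ j)) z≤n
ballot-mono (suc a) (suc j) le with m≤n⇒m<n∨m≡n le
... | inj₂ refl     = ≤-refl
... | inj₁ (s≤s lt) = begin
  ballot (suc j) a + ballot j (suc a) ≤⟨ +-mono-≤ (ballot-mono a (suc j) (m≤n⇒m≤1+n (≤-trans (n≤1+n a) lt))) (ballot-mono (suc a) j lt) ⟩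
  ballot a (suc j) + ballot (suc a) j ≡⟨ +-comm (ballot a (suc j)) _ ⟩
  ballot (suc a) j + ballot a (suc j) ∎
  where open ≤-Reasoning

-- Against a final descent something can also be taken on the left: the ascent is `f 0` itself or
-- satisfies the guard. `schemes-pos` then yields one more scheme.
schemes-last-des : ∀ f m → f m ≡ false → anyAsc f m ≡ true → suc (schemes f m) ≤ schemes f (suc m)
schemes-last-des f (suc m) e a rewrite e with f 0
... | true = subst (_≤ schemes f (suc m) + schemes (f ∘ suc) (suc m)) (+-comm _ 1)
               (+-monoʳ-≤ (schemes f (suc m)) (schemes-pos (f ∘ suc) m))
schemes-last-des f (suc (suc m)) e a | false rewrite a =
  subst (_≤ schemes f (suc (suc m)) + schemes (f ∘ suc) (suc m)) (+-comm _ 1)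
    (+-monoʳ-≤ (schemes f (suc (suc m))) (schemes-pos (f ∘ suc) m))

-- The conditional is what `schemes` adds when two descents go at once; the right side is what it
-- adds after the first of them is flipped to an ascent.
skip-bound : ∀ g m → g m ≡ false →
  suc (if anyAsc g m then schemes g m else 0) ≤ schemes g (suc m)
skip-bound g m e with anyAsc g m in eq
... | true  = schemes-last-des g m e eq
... | false = schemes-pos g m

flip-step₀ : ∀ g m →
  Φ 0 (false · g) (suc m) + ballot 0 (des g m) ≤ Φ 1 g m + ballot (des g m) 0 →
  Φ 0 (false · g) (2 + m) + ballot 0 (des g (suc m)) ≤ Φ 1 g (suc m) + ballot (des g (suc m)) 0
flip-step₀ g m ih rewrite des-snoc g m with g m in eq
... | true rewrite +-identityʳ (des g m) | +-identityʳ (schemes (false · g) (suc m))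
                 | +-identityʳ (schemes (true · g) (suc m)) = ih
... | false
  rewrite +-comm (des g m) 1 = begin
  X + E + suc j              ≡⟨ +-suc (X + E) j ⟩
  suc (X + E + j)            ≡⟨ cong suc (xy∙z≈xz∙y X E j) ⟩
  suc (X + j + E)            ≡⟨ +-suc (X + j) E ⟨
  -- The new descent raises `ballot 0` by one while `ballot (suc j) 0` stays 0; the surplus of one
  -- in `skip-bound` pays for it.
  X + j + suc E              ≤⟨ +-mono-≤ ih (skip-bound g m eq) ⟩
  Y + ballot j 0 + Z         ≡⟨ cong (λ k → Y + k + Z) (ballot-zeroʳ j) ⟩
  Y + 0 + Z                  ≡⟨ cong (_+ Z) (+-identityʳ Y) ⟩
  Y + Z                      ≡⟨ +-identityʳ _ ⟨
  Y + Z + 0                  ∎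
  where
  open ≤-Reasoning
  open import Algebra.Properties.CommutativeSemigroup +-commutativeSemigroup using (xy∙z≈xz∙y)
  X = schemes (false · g) (suc m)
  E = if anyAsc g m then schemes g m else 0
  Y = schemes (true · g) (suc m)
  Z = schemes g (suc m)
  j = des g m

-- A final ascent changes neither side. A final descent splits both counts by `Φ-last-des` and both
-- ballot terms by their recursion, so the two hypotheses add up.
flip-step : ∀ a g m →
  Φ (suc a) (false · g) (suc m) + ballot (suc a) (des g m) ≤ Φ (2 + a) g m + ballot (des g m) (suc a) →
  Φ a (false · g) (2 + m) + ballot a (des g (suc m)) ≤ Φ (suc a) g (suc m) + ballot (des g (suc m)) a →
  Φ (suc a) (false · g) (2 + m) + ballot (suc a) (des g (suc m)) ≤
    Φ (2 + a) g (suc m) + ballot (des g (suc m)) (suc a)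
flip-step a g m ih₁ ih₂ rewrite des-snoc g m with g m in eq
... | true
  rewrite +-identityʳ (des g m) | Φ-last-asc a (false · g) (suc m) eq | Φ-last-asc (suc a) g m eq
  = ih₁
... | false
  rewrite +-comm (des g m) 1 = begin
  Φ (suc a) (false · g) (2 + m) + (q₁ + q₂)  ≡⟨ cong (_+ (q₁ + q₂)) (Φ-last-des a (false · g) (suc m) eq) ⟩
  (x₁ + x₂) + (q₁ + q₂)                      ≡⟨ interchange x₁ x₂ q₁ q₂ ⟩
  (x₁ + q₁) + (x₂ + q₂)                      ≤⟨ +-mono-≤ ih₁ ih₂ ⟩
  (y₁ + r₁) + (y₂ + r₂)                      ≡⟨ interchange y₁ r₁ y₂ r₂ ⟩
  (y₁ + y₂) + (r₁ + r₂)                      ≡⟨ cong₂ _+_ (sym (Φ-last-des (suc a) g m eq)) (+-comm r₁ r₂) ⟩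
  Φ (2 + a) g (suc m) + (r₂ + r₁)            ∎
  where
  open ≤-Reasoning
  open import Algebra.Properties.CommutativeSemigroup +-commutativeSemigroup using (interchange)
  j = des g m
  x₁ = Φ (suc a) (false · g) (suc m)
  x₂ = Φ a (false · g) (2 + m)
  q₁ = ballot (suc a) j
  q₂ = ballot a (suc j)
  y₁ = Φ (2 + a) g m
  y₂ = Φ (suc a) g (suc m)
  r₁ = ballot j (suc a)
  r₂ = ballot (suc j) a

-- The bare inequality of `flip-des` is not inductive, since with few descents a flip loses schemes.
-- The ballot difference, possibly negative, bounds the gain from below; for `m = 0` there is
-- equality.
flip-ballot : ∀ a g m →
  Φ a (false · g) (suc m) + ballot a (des g m) ≤ Φ (suc a) g m + ballot (des g m) a
flip-ballot zero    g zero = ≤-refl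
flip-ballot (suc a) g zero rewrite Φ-last-des a (false · g) 0 refl | Φ-asc-only (suc a) g = go a
  where
  -- With a single descent, at the end, a scheme is determined by how many of the `a` ascents are
  -- taken on the left first.
  hd : ∀ a → Φ a (false · g) 1 ≡ suc a
  hd zero    = refl
  hd (suc a) = trans (Φ-last-des a (false · g) 0 refl)
                     (cong₂ _+_ (Φ-asc-only a (false · g)) (hd a))
  go : ∀ a → Φ (suc a) (false · g) 0 + Φ a (false · g) 1 + 0 ≤ 1 + suc a
  go a rewrite hd a | Φ-asc-only a (false · g) = ≤-reflexive (+-identityʳ _)
flip-ballot zero    g (suc m) = flip-step₀ g m (flip-ballot zero g m)
flip-ballot (suc a) g (suc m) = flip-step a g m (flip-ballot (suc a) g m) (flip-ballot a g (suc m))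

flip-des : ∀ a g m → a ≤ des g m → Φ a (false · g) (suc m) ≤ Φ (suc a) g m
flip-des a g m le = +-cancelʳ-≤ (ballot a (des g m)) _ _
  (≤-trans (flip-ballot a g m) (+-monoʳ-≤ (Φ (suc a) g m) (ballot-mono a (des g m) le)))

des-first-asc : ∀ g m → g 0 ≡ true → des g (suc m) ≡ des (g ∘ suc) m
des-first-asc g m e rewrite e = refl

des-first-des : ∀ g m → g 0 ≡ false → des g (suc m) ≡ suc (des (g ∘ suc) m)
des-first-des g m e rewrite e = refl

no-des-bound : ∀ g m → des g m ≡ 0 → schemes g m ≤ 1
no-des-bound g zero          e = z≤n
no-des-bound g (suc zero)    e = ≤-refl
no-des-bound g (suc (suc m)) e =
  subst (_≤ 1) (sym (schemes-last-asc g m (weight≡0 (g (suc m)) (m+n≡0⇒n≡0 (des g (suc m)) e′))))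
    (no-des-bound g (suc m) (m+n≡0⇒m≡0 (des g (suc m)) e′))
  where
  e′ : des g (suc m) + desWeight (g (suc m)) ≡ 0
  e′ = trans (sym (des-snoc g (suc m))) e
  weight≡0 : ∀ b → desWeight b ≡ 0 → b ≡ true
  weight≡0 true _ = refl

-- Pascal's rule applies to both ends; when taking an ascent on the left would break
-- des g m ≤ a, the first letter of g is absorbed into, or flipped to join, the prefix.
few-des-bound : ∀ m a g → des g m ≤ a → Φ a g m ≤ (a + m) C des g m
few-des-bound m zero g le rewrite n≤0⇒n≡0 le = no-des-bound g m (n≤0⇒n≡0 le)
few-des-bound zero (suc a) g le = ≤-reflexive (Φ-asc-only a g)
few-des-bound (suc m) (suc a) g le rewrite des-snoc g m with g m in eq
... | true rewrite +-identityʳ (des g m) | Φ-last-asc a g m eq = begin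
  Φ (suc a) g m                 ≤⟨ few-des-bound m (suc a) g le ⟩
  (suc a + m) C des g m         ≤⟨ C-suc-mono (suc a + m) (des g m) ⟩
  suc (suc a + m) C des g m     ≡⟨ cong (_C des g m) (+-suc (suc a) m) ⟨
  (suc a + suc m) C des g m     ∎
  where open ≤-Reasoning
... | false rewrite +-comm (des g m) 1 = begin
  Φ (suc a) g (suc m)                      ≡⟨ Φ-last-des a g m eq ⟩
  Φ (suc a) g m + Φ a g (suc m)            ≤⟨ +-mono-≤ (few-des-bound m (suc a) g (≤-trans (n≤1+n _) le)) rest ⟩
  (suc a + m) C j + (suc a + m) C suc j    ≡⟨ pascal (suc a + m) j ⟨
  suc (suc a + m) C suc j                  ≡⟨ cong (_C suc j) (+-suc (suc a) m) ⟨
  (suc a + suc m) C suc j                  ∎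
  where
  open ≤-Reasoning
  j = des g m
  d≡ : des g (suc m) ≡ suc j
  d≡ = trans (des-snoc g m) (trans (cong (λ b → j + desWeight b) eq) (+-comm j 1))
  rest : Φ a g (suc m) ≤ (suc a + m) C suc j
  rest with m≤n⇒m<n∨m≡n le
  ... | inj₁ (s≤s lt) = begin
    Φ a g (suc m)              ≤⟨ few-des-bound (suc m) a g (subst (_≤ a) (sym d≡) lt) ⟩
    (a + suc m) C des g (suc m) ≡⟨ cong₂ _C_ (+-suc a m) d≡ ⟩
    (suc a + m) C suc j        ∎
  ... | inj₂ j≡a with g 0 in e
  ...   | true  = begin
    Φ a g (suc m)                         ≡⟨ Φ-first-asc a g m e ⟩
    Φ (suc a) (g ∘ suc) m                 ≤⟨ few-des-bound m (suc a) (g ∘ suc) (subst (_≤ suc a) (sym d'≡) le) ⟩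
    (suc a + m) C des (g ∘ suc) m         ≡⟨ cong ((suc a + m) C_) d'≡ ⟩
    (suc a + m) C suc j                   ∎
    where
    d'≡ : des (g ∘ suc) m ≡ suc j
    d'≡ = trans (sym (des-first-asc g m e)) d≡
  ...   | false = begin
    Φ a g (suc m)                         ≡⟨ Φ-first-des a g (suc m) e ⟩
    Φ a (false · (g ∘ suc)) (suc m)       ≤⟨ flip-des a (g ∘ suc) m (≤-reflexive (sym (trans d'≡ (suc-injective j≡a)))) ⟩
    Φ (suc a) (g ∘ suc) m                 ≤⟨ few-des-bound m (suc a) (g ∘ suc) (subst (_≤ suc a) (sym d'≡) (≤-trans (n≤1+n _) le)) ⟩
    (suc a + m) C des (g ∘ suc) m         ≡⟨ cong ((suc a + m) C_) d'≡ ⟩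
    -- The flip costs one descent. Here `suc j ≡ suc a` and `j ≤ m`, so `j` lies far enough in the
    -- lower half for `C-step-up` to restore it.
    (suc a + m) C j                       ≤⟨ C-step-up (suc a + m) j (≤-trans (+-mono-≤ (des≤ g m) (≤-reflexive j≡a)) (≤-reflexive (+-comm m (suc a)))) ⟩
    (suc a + m) C suc j                   ∎
    where
    d'≡ : des (g ∘ suc) m ≡ j
    d'≡ = suc-injective (trans (sym (des-first-des g m e)) d≡)

-- As long as descents outnumber `a`, the first letter joins the prefix, by `flip-des` if it is a
-- descent, with `a + m` fixed. At the latest when `m = 0` the descents no longer outnumber `a`.
Φ≤central : ∀ m a g → Φ a g m ≤ central (a + m)
Φ≤central m a g with ≤-<-connex (des g m) a
... | inj₁ le = ≤-trans (few-des-bound m a g le)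
                  (C≤central (a + m) (des g m) (≤-trans le (m≤m+n a m)))
Φ≤central (suc m) a g | inj₂ gt with g 0 in e
... | true  rewrite Φ-first-asc a g m e =
      subst (λ k → Φ (suc a) (g ∘ suc) m ≤ central k) (sym (+-suc a m)) (Φ≤central m (suc a) (g ∘ suc))
... | false rewrite Φ-first-des a g (suc m) e =
      ≤-trans (flip-des a (g ∘ suc) m (s≤s⁻¹ gt))
        (subst (λ k → Φ (suc a) (g ∘ suc) m ≤ central k) (sym (+-suc a m)) (Φ≤central m (suc a) (g ∘ suc)))

schemes≤central : ∀ f m → schemes f m ≤ central m
schemes≤central f m = Φ≤central m 0 f
-- The stack machine

if-elim : ∀ {A : Set} (P : A → Set) {x y : A} b →
          (b ≡ true → P x) → (b ≡ false → P y) → P (if b then x else y)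
if-elim P true  t f = t refl
if-elim P false t f = f refl

true≢false : ∀ {A : Set} {b} → b ≡ true → b ≡ false → A
true≢false refl ()

true⊎false : ∀ b → b ≡ true ⊎ b ≡ false
true⊎false true  = inj₁ refl
true⊎false false = inj₂ refl

ʳ++-++ : ∀ (xs : List ℕ) {ys zs} → (xs ʳ++ ys) ++ zs ≡ xs ʳ++ (ys ++ zs)
ʳ++-++ []       = refl
ʳ++-++ (x ∷ xs) = ʳ++-++ xs

module Machine (σ : Triple) (_≺_ : ℕ → ℕ → Bool)
  (pattern-σ : ∀ a b c → sameOrder (a , b , c) σ ≡ not (a ≺ b) ∧ not (a ≺ c) ∧ (b ≺ c))
  (≺-trans  : ∀ {a b c} → (a ≺ b) ≡ true → (b ≺ c) ≡ true → (a ≺ c) ≡ true)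
  (≺-cotrans : ∀ {a b c} → (a ≺ b) ≡ false → (b ≺ c) ≡ false → (a ≺ c) ≡ false)
  where

  blocked : ℕ → ℕ → List ℕ → Bool
  blocked x s []      = false
  blocked x s (t ∷ _) = not (x ≺ s) ∧ not (x ≺ t) ∧ (s ≺ t)

  process : List ℕ → List ℕ → List ℕ
  process []       st       = st
  process (x ∷ xs) []       = process xs (x ∷ [])
  process (x ∷ xs) (s ∷ st) =
    if blocked x s st then s ∷ process (x ∷ xs) st else process xs (x ∷ s ∷ st)

  contains-push : ∀ x s st → containsConsec σ (s ∷ st) ≡ false →
                  containsConsec σ (x ∷ s ∷ st) ≡ blocked x s st
  contains-push x s []       h = refl
  contains-push x s (t ∷ st) h rewrite h = trans (∨-identityʳ _) (pattern-σ x s t)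

  contains-pop : ∀ s st → containsConsec σ (s ∷ st) ≡ false → containsConsec σ st ≡ false
  contains-pop s []           h = refl
  contains-pop s (t ∷ [])     h = refl
  contains-pop s (t ∷ u ∷ st) h with sameOrder (s , t , u) σ
  ... | false = h

  -- The stack avoids `σ` throughout, so a push can create an occurrence only in the top three
  -- entries, and testing `blocked` suffices.
  run≡process : ∀ xs st → containsConsec σ st ≡ false → run σ xs st ≡ process xs st
  run≡process []       st       h = refl
  run≡process (x ∷ xs) []       h = run≡process xs (x ∷ []) refl
  run≡process (x ∷ xs) (s ∷ st) h = step (blocked x s st) (contains-push x s st h)
    (cong (s ∷_) (run≡process (x ∷ xs) st (contains-pop s st h)))
    (λ e → run≡process xs (x ∷ s ∷ st) (trans (contains-push x s st h) e))
    where
    step : ∀ b → containsConsec σ (x ∷ s ∷ st) ≡ b →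
           s ∷ run σ (x ∷ xs) st ≡ s ∷ process (x ∷ xs) st →
           (b ≡ false → run σ xs (x ∷ s ∷ st) ≡ process xs (x ∷ s ∷ st)) →
           run σ (x ∷ xs) (s ∷ st) ≡
           (if b then s ∷ process (x ∷ xs) st else process xs (x ∷ s ∷ st))
    step true  e p q rewrite e = p
    step false e p q rewrite e = q refl

  process-push : ∀ x xs s st → blocked x s st ≡ false →
                 process (x ∷ xs) (s ∷ st) ≡ process xs (x ∷ s ∷ st)
  process-push x xs s st e rewrite e = refl

  process-pop : ∀ x xs s st → blocked x s st ≡ true →
                process (x ∷ xs) (s ∷ st) ≡ s ∷ process (x ∷ xs) st
  process-pop x xs s st e rewrite e = refl

  -- Pops can only clear `Y`: once `a` is on top, every arriving entry is pushed on it.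
  stays : ∀ xs Y a T → (∀ x → blocked x a T ≡ false) →
          ∃ λ v → process xs (Y ++ a ∷ T) ≡ v ++ a ∷ T
  stays []       Y  a T h = Y , refl
  stays (x ∷ xs) [] a T h rewrite h x = stays xs (x ∷ []) a T h
  stays (x ∷ xs) (y ∷ Y) a T h =
    if-elim (λ out → ∃ λ v → out ≡ v ++ a ∷ T) (blocked x y (Y ++ a ∷ T))
      (λ _ → let v , e = stays (x ∷ xs) Y a T h in y ∷ v , cong (y ∷_) e)
      (λ _ → stays xs (x ∷ y ∷ Y) a T h)

  blocked-no-ascent : ∀ a b T → (a ≺ b) ≡ false → ∀ x → blocked x a (b ∷ T) ≡ false
  blocked-no-ascent a b T h x rewrite h | ∧-zeroʳ (not (x ≺ b)) = ∧-zeroʳ (not (x ≺ a))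

  top : ℕ → List ℕ → ℕ
  top d []      = d
  top d (r ∷ R) = r

  -- `R ++ [ d ]` increases under `≺` from top to bottom: a block whose entries are popped together
  -- or not at all before the input ends.
  data Chain (d : ℕ) : List ℕ → Set where
    []  : Chain d []
    _∷_ : ∀ {r R} → (r ≺ top d R) ≡ true → Chain d R → Chain d (r ∷ R)

  blocked-top : ∀ x r R d T → blocked x r (R ++ d ∷ T) ≡
                not (x ≺ r) ∧ not (x ≺ top d R) ∧ (r ≺ top d R)
  blocked-top x r []      d T = refl
  blocked-top x r (_ ∷ _) d T = refl

  blocked-below : ∀ x s T → (x ≺ s) ≡ true → blocked x s T ≡ false
  blocked-below x s []      h = refl
  blocked-below x s (t ∷ T) h rewrite h = refl

  ++-∷ : ∀ (v : List ℕ) a T → v ++ a ∷ T ≡ (v ∷ʳ a) ++ T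
  ++-∷ v a T = sym (++-assoc v [ a ] T)

  -- If the popping stops inside the block, `x` lands on an entry `r` with `x ⊀ r`, which by `stays`
  -- freezes everything below. Otherwise the whole block goes.
  pops : ∀ x xs R d s T → Chain d R → (d ≺ s) ≡ true → (x ≺ top d R) ≡ false →
    (∃ λ v → process (x ∷ xs) (R ++ d ∷ s ∷ T) ≡ v ++ d ∷ s ∷ T) ⊎
    ((x ≺ s) ≡ false ×
      process (x ∷ xs) (R ++ d ∷ s ∷ T) ≡ (R ++ [ d ]) ++ process (x ∷ xs) (s ∷ T))
  pops x xs [] d s T c ds xd with true⊎false (x ≺ s)
  ... | inj₁ eq = inj₁ (_ , trans (process-push x xs d (s ∷ T) b) (trans (proj₂ p) (++-∷ _ x (d ∷ s ∷ T))))
    where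
    b : blocked x d (s ∷ T) ≡ false
    b rewrite eq = ∧-zeroʳ (not (x ≺ d))
    p = stays xs [] x (d ∷ s ∷ T) (blocked-no-ascent x d (s ∷ T) xd)
  ... | inj₂ eq = inj₂ (eq , process-pop x xs d (s ∷ T) b)
    where
    b : blocked x d (s ∷ T) ≡ true
    b rewrite xd | eq = ds
  pops x xs (r ∷ R) d s T (rt ∷ c) ds xr with true⊎false (x ≺ top d R)
  ... | inj₁ eq = inj₁ (_ , trans (process-push x xs r _ b)
                  (trans (proj₂ p) (sym (++-assoc (proj₁ p) (x ∷ r ∷ R) (d ∷ s ∷ T)))))
    where
    b : blocked x r (R ++ d ∷ s ∷ T) ≡ false
    b rewrite blocked-top x r R d (s ∷ T) | eq = ∧-zeroʳ (not (x ≺ r))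
    p = stays xs [] x (r ∷ R ++ d ∷ s ∷ T) (blocked-no-ascent x r (R ++ d ∷ s ∷ T) xr)
  ... | inj₂ eq with process-pop x xs r (R ++ d ∷ s ∷ T)
                     (trans (blocked-top x r R d (s ∷ T)) (lem xr eq rt)) | pops x xs R d s T c ds eq
    where
    lem : ∀ {a b c} → a ≡ false → b ≡ false → c ≡ true → not a ∧ not b ∧ c ≡ true
    lem refl refl refl = refl
  ...   | e | inj₁ (v , e′) = inj₁ (r ∷ v , trans e (cong (r ∷_) e′))
  ...   | e | inj₂ (h , e′) = inj₂ (h , trans e (cong (r ∷_) e′))

  process-below : ∀ x xs R d T → (x ≺ top d R) ≡ true →
                  process (x ∷ xs) (R ++ d ∷ T) ≡ process xs (x ∷ R ++ d ∷ T)
  process-below x xs []      d T h = process-push x xs d T (blocked-below x d T h)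
  process-below x xs (r ∷ R) d T h = process-push x xs r (R ++ d ∷ T) (blocked-below x r (R ++ d ∷ T) h)

  -- Entries `≺` the top extend the block; the first other one is settled by `pops`. The `ʳ++`
  -- equation records that the block arrived in reverse.
  fate : ∀ xs R d s T → Chain d R → (d ≺ s) ≡ true →
    (∃ λ v → process xs (R ++ d ∷ s ∷ T) ≡ v ++ d ∷ s ∷ T) ⊎
    (∃ λ R′ → ∃ λ x → ∃ λ xs′ → Chain d R′ × R′ ʳ++ (x ∷ xs′) ≡ R ʳ++ xs × (x ≺ s) ≡ false ×
      process xs (R ++ d ∷ s ∷ T) ≡ (R′ ++ [ d ]) ++ process (x ∷ xs′) (s ∷ T))
  fate []       R d s T c ds = inj₁ (R , refl)
  fate (x ∷ xs) R d s T c ds with true⊎false (x ≺ top d R)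
  ... | inj₁ eq rewrite process-below x xs R d (s ∷ T) eq = fate xs (x ∷ R) d s T (eq ∷ c) ds
  ... | inj₂ eq with pops x xs R d s T c ds eq
  ...   | inj₁ p       = inj₁ p
  ...   | inj₂ (h , e) = inj₂ (R , x , xs , c , refl , h , e)

  -- Reconstructing the input from the output

  letters : (ℕ → ℕ) → Word
  letters p i = p i ≺ p (suc i)

  -- The inputs that turn into p 0 … p (m - 1) on a surviving stack with top p m, where
  -- q lists the entries already chosen to be pushed and then popped by p (m - 1).
  candidates : (ℕ → ℕ) → ℕ → List ℕ → List (List ℕ)
  candidates p zero          q = []
  candidates p (suc zero)    q = (q ++ p 0 ∷ []) ∷ []
  candidates p (suc (suc m)) q =
    map (λ r → q ++ p (suc m) ∷ r) (candidates p (suc m) []) ++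
    (if letters p (suc m) then []
     else if letters p 0 then candidates (p ∘ suc) (suc m) (p 0 ∷ q)
     else if anyAsc (letters (p ∘ suc)) m
       then map (λ r → (p 0 ∷ q) ++ p (suc m) ∷ r) (candidates (p ∘ suc) m [])
     else [])

  length-candidates : ∀ p m q → length (candidates p m q) ≡ schemes (letters p) m
  length-candidates p zero          q = refl
  length-candidates p (suc zero)    q = refl
  length-candidates p (suc (suc m)) q = trans (length-++ (map _ (candidates p (suc m) [])))
    (cong₂ _+_ (trans (length-map _ (candidates p (suc m) [])) (length-candidates p (suc m) []))
      (step (letters p (suc m)) (letters p 0) (anyAsc (letters (p ∘ suc)) m)
        (length-candidates (p ∘ suc) (suc m) (p 0 ∷ q))
        (trans (length-map _ (candidates (p ∘ suc) m [])) (length-candidates (p ∘ suc) m []))))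
    where
    step : ∀ b₁ b₂ b₃ {xs ys : List (List ℕ)} {k l} → length xs ≡ k → length ys ≡ l →
      length (if b₁ then [] else if b₂ then xs else if b₃ then ys else []) ≡
      (if b₁ then 0 else if b₂ then k else if b₃ then l else 0)
    step true  _     _     e₁ e₂ = refl
    step false true  _     e₁ e₂ = e₁
    step false false true  e₁ e₂ = e₂
    step false false false e₁ e₂ = refl

  -- Differs from `candidates` only at 0: with nothing left to output the empty input is valid,
  -- whereas a candidate must still contain a staying entry.
  inputs : (ℕ → ℕ) → ℕ → List (List ℕ)
  inputs p zero    = [] ∷ []
  inputs p (suc m) = candidates p (suc m) []

  -- Justifies the guard `anyAsc`: without an ascent in between, `p 0` cannot be `≺` the surviving
  -- top, as a popped entry must be.
  desc-trans : ∀ m p z → (z ≺ p 0) ≡ false → anyAsc (letters p) m ≡ false → (z ≺ p m) ≡ false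
  desc-trans zero    p z h _ = h
  desc-trans (suc m) p z h a with p 0 ≺ p 1 in eq
  ... | false = desc-trans m (p ∘ suc) z (≺-cotrans h eq) a

  -- `W` is the block popped by `p M`. Consecutive entries of the block are ascents of `p`, so
  -- `candidates` can collect them one by one until the block ends.
  block-∈ : ∀ W p q r k M → M ≡ length W + k → W ≡ applyUpTo p (length W) →
    Chain (p (suc M)) W → (W ≡ [] ⊎ (p M ≺ p (suc M)) ≡ false) →
    r ∈ inputs (λ i → p (length W + i)) k →
    (W ʳ++ q) ++ p M ∷ r ∈ candidates p (suc M) q
  block-∈ [] p q r zero    .0       refl W≡ c x (here refl) = here refl
  block-∈ [] p q r (suc k) .(suc k) refl W≡ c x r∈ = ∈-++⁺ˡ (∈-map⁺ _ r∈)
  block-∈ (w ∷ W) p q r k (suc m) M≡ W≡ (h ∷ c) (inj₂ x≺s) r∈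
    with refl ← ∷-injectiveˡ W≡ = ∈-++⁺ʳ _ (later _ refl)
    where
    rest = λ b → if b then candidates (p ∘ suc) (suc m) (p 0 ∷ q)
      else if anyAsc (letters (p ∘ suc)) m
        then map (λ r → (p 0 ∷ q) ++ p (suc m) ∷ r) (candidates (p ∘ suc) m [])
        else []
    -- Here `p 0` starts a descent, so the block cannot continue to `p 1`: it ends, and `p M`
    -- arrives next. This is the branch that takes two descents at once.
    diagonal : ∀ W → W ≡ applyUpTo (p ∘ suc) (length W) → (w ≺ top (p (suc (suc m))) W) ≡ true →
      (p 0 ≺ p 1) ≡ false → r ∈ inputs (λ i → p (suc (length W + i))) k → m ≡ length W + k →
      (W ʳ++ w ∷ q) ++ p (suc m) ∷ r ∈ rest false
    diagonal (w′ ∷ W) W≡ h eq r∈ m≡ with refl ← ∷-injectiveˡ W≡ = true≢false h eq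
    diagonal [] W≡ h eq r∈ m≡ with true⊎false (anyAsc (letters (p ∘ suc)) m)
    ... | inj₂ a = true≢false h (≺-cotrans (desc-trans m (p ∘ suc) (p 0) eq a) x≺s)
    ... | inj₁ a rewrite a =
      ∈-map⁺ _ (positive m a (subst (λ k → r ∈ inputs (p ∘ suc) k) (sym m≡) r∈))
      where
      -- The guard excludes `k = 0`, the one place where `inputs` and `candidates` differ.
      positive : ∀ k → anyAsc (letters (p ∘ suc)) k ≡ true → r ∈ inputs (p ∘ suc) k →
                 r ∈ candidates (p ∘ suc) k []
      positive (suc k) a r∈ = r∈
    later : ∀ b → letters p 0 ≡ b → (W ʳ++ w ∷ q) ++ p (suc m) ∷ r ∈
      (if letters p (suc m) then [] else rest (letters p 0))
    later b eq rewrite x≺s with b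
    ... | true  rewrite eq = block-∈ W (p ∘ suc) (w ∷ q) r k m (suc-injective M≡) (∷-injectiveʳ W≡) c (inj₂ x≺s) r∈
    ... | false rewrite eq = diagonal W (∷-injectiveʳ W≡) h eq r∈ (suc-injective M≡)

  Distinct : (ℕ → ℕ) → ℕ → Set
  Distinct p m = ∀ i j → i < j → j ≤ m → p i ≢ p j

  applyUpTo-prefix : ∀ W v (p : ℕ → ℕ) m → W ++ v ≡ applyUpTo p m →
    W ≡ applyUpTo p (length W) × m ≡ length W + length v ×
    v ≡ applyUpTo (λ i → p (length W + i)) (length v)
  applyUpTo-prefix [] v p m e = refl , trans (sym (length-applyUpTo p m)) (sym (cong length e)) ,
    trans e (cong (applyUpTo p) (trans (sym (length-applyUpTo p m)) (sym (cong length e))))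
  applyUpTo-prefix (w ∷ W) v p (suc m) e with ∷-injective e
  ... | refl , e′ with applyUpTo-prefix W v (p ∘ suc) m e′
  ...   | a , b , c = cong (p 0 ∷_) a , cong suc b , c

  applyUpTo-at : ∀ W c U (p : ℕ → ℕ) m V → W ++ c ∷ U ≡ applyUpTo p m ++ V →
                 length W < m → c ≡ p (length W)
  applyUpTo-at []      c U p (suc m) V e lt       = ∷-injectiveˡ e
  applyUpTo-at (w ∷ W) c U p (suc m) V e (s≤s lt) =
    applyUpTo-at W c U (p ∘ suc) m V (∷-injectiveʳ e) lt

  -- The recursion passes to the length of the output left after the first block, hence the bound
  -- `b`. Distinctness ensures that the surviving top is not output early.
  inputs-complete : ∀ b m → m ≤ b → ∀ p xs T → Distinct p m → length xs ≡ m →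
    process xs (p m ∷ T) ≡ applyUpTo p m ++ p m ∷ T → xs ∈ inputs p m
  inputs-complete b zero le p [] T dist len out = here refl
  inputs-complete (suc b) (suc m) (s≤s le) p (x ∷ xs) T dist len out = go
    where
    s = p (suc m)

    -- `c` is the first entry to stay on `s`, and `W` the block popped before it. The output reads
    -- `W`, `v`, `c`, `s`, `T`, so `c` is `p m` and `r` is an input producing `v` over `c`.
    conclude : ∀ W c r → Chain s W → (W ≡ [] ⊎ (c ≺ s) ≡ false) → W ʳ++ (c ∷ r) ≡ x ∷ xs →
      (∃ λ v → process r (c ∷ s ∷ T) ≡ v ++ c ∷ s ∷ T) →
      W ++ process r (c ∷ s ∷ T) ≡ applyUpTo p (suc m) ++ s ∷ T → x ∷ xs ∈ candidates p (suc m) []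
    conclude W c r ch cs split (v , e) out′
      with applyUpTo-prefix W v p m (proj₁ both) | proj₂ both
      where
      both : W ++ v ≡ applyUpTo p m × c ≡ p m
      both = ∷ʳ-injective (W ++ v) (applyUpTo p m) (begin
        (W ++ v) ++ [ c ]        ≡⟨ ++-cancelʳ (s ∷ T) _ _ (begin
           ((W ++ v) ++ [ c ]) ++ s ∷ T  ≡⟨ ++-assoc (W ++ v) [ c ] (s ∷ T) ⟩
           (W ++ v) ++ c ∷ s ∷ T         ≡⟨ ++-assoc W v _ ⟩
           W ++ v ++ c ∷ s ∷ T           ≡⟨ cong (W ++_) e ⟨
           W ++ process r (c ∷ s ∷ T)    ≡⟨ out′ ⟩
           applyUpTo p (suc m) ++ s ∷ T  ∎) ⟩
        applyUpTo p (suc m)      ≡⟨ applyUpTo-∷ʳ p m ⟨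
        applyUpTo p m ++ [ p m ] ∎)
        where open ≡-Reasoning
    ... | W≡ , m≡ , v≡ | refl = subst (_∈ candidates p (suc m) []) eq
      (block-∈ W p [] r (length v) m m≡ W≡ ch cs r∈)
      where
      eq : (W ʳ++ []) ++ p m ∷ r ≡ x ∷ xs
      eq = trans (ʳ++-++ W) split
      p′ = λ i → p (length W + i)
      k = length v
      pk : p′ k ≡ p m
      pk = cong p (sym m≡)
      lenr : length r ≡ k
      lenr = suc-injective (+-cancelˡ-≡ (length W) _ _ (begin
        length W + suc (length r)    ≡⟨ length-ʳ++ W ⟨
        length (W ʳ++ (p m ∷ r))     ≡⟨ cong length split ⟩
        suc (length xs)              ≡⟨ len ⟩
        suc m                        ≡⟨ cong suc m≡ ⟩
        suc (length W + k)           ≡⟨ +-suc (length W) k ⟨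
        length W + suc k             ∎))
        where open ≡-Reasoning
      k≤m : k ≤ m
      k≤m = subst (k ≤_) (sym m≡) (m≤n+m k (length W))
      dist′ : Distinct p′ k
      dist′ i j i<j j≤k = dist _ _ (+-monoʳ-< (length W) i<j)
        (m≤n⇒m≤1+n (subst (length W + j ≤_) (sym m≡) (+-monoʳ-≤ (length W) j≤k)))
      r∈ : r ∈ inputs p′ k
      r∈ = inputs-complete b k (≤-trans k≤m le) p′ r (s ∷ T) dist′ lenr
        (subst (λ c → process r (c ∷ s ∷ T) ≡ applyUpTo p′ k ++ c ∷ s ∷ T) (sym pk)
          (trans e (cong (_++ p m ∷ s ∷ T) v≡)))

    -- A pop of `s` would put `p (suc m)` at output position `length W`, which is below `suc m`
    -- because `c` itself is still unread.
    no-early-pop : ∀ W c r V → length W + suc (length r) ≡ suc m →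
      W ++ process (c ∷ r) (s ∷ T) ≡ applyUpTo p (suc m) ++ V → blocked c s T ≡ false
    no-early-pop W c r V lenW e with blocked c s T
    ... | false = refl
    ... | true  = ⊥-elim (dist (length W) (suc m) lt ≤-refl
                    (sym (applyUpTo-at W s _ p (suc m) V e lt)))
      where
      lt : length W < suc m
      lt = subst (length W <_) lenW (m<m+n (length W) (s≤s z≤n))

    go : x ∷ xs ∈ candidates p (suc m) []
    go with no-early-pop [] x xs _ len out
    ... | safe with true⊎false (x ≺ s)
    ...   | inj₂ xs≡ = conclude [] x xs [] (inj₁ refl) refl
              (stays xs [] x (s ∷ T) (blocked-no-ascent x s T xs≡))
              (trans (sym (process-push x xs s T safe)) out)
    ...   | inj₁ xs≡ with fate xs [] x s T [] xs≡
    ...     | inj₁ perm = conclude [] x xs [] (inj₁ refl) refl perm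
                (trans (sym (process-push x xs s T safe)) out)
    ...     | inj₂ (R , c , r , chR , split , cs , e) =
      conclude W c r (chain-snoc R chR) (inj₂ cs) splitW
        (stays r [] c (s ∷ T) (blocked-no-ascent c s T cs))
        (trans (cong (W ++_) (sym (process-push c r s T safe′))) out′)
      where
      -- `x` is the bottom of its block, hence the last entry of it to be output.
      W = R ++ [ x ]
      chain-snoc : ∀ R → Chain x R → Chain s (R ++ [ x ])
      chain-snoc []          []       = xs≡ ∷ []
      chain-snoc (r ∷ [])    (h ∷ ch) = h ∷ chain-snoc [] ch
      chain-snoc (r ∷ r′ ∷ R) (h ∷ ch) = h ∷ chain-snoc (r′ ∷ R) ch
      splitW : W ʳ++ (c ∷ r) ≡ x ∷ xs
      splitW = trans (++-ʳ++ R) (cong (x ∷_) split)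
      out′ : W ++ process (c ∷ r) (s ∷ T) ≡ applyUpTo p (suc m) ++ s ∷ T
      out′ = trans (sym e) (trans (sym (process-push x xs s T safe)) out)
      safe′ : blocked c s T ≡ false
      safe′ = no-early-pop W c r _ (trans (sym (length-ʳ++ W)) (trans (cong length splitW) len)) out′
-- Counting preimages

Unique-⊆-length : ∀ {A : Set} {xs ys : List A} → Unique xs →
                  (∀ {x} → x ∈ xs → x ∈ ys) → length xs ≤ length ys
Unique-⊆-length {xs = []}     _        sub = z≤n
Unique-⊆-length {xs = x ∷ xs} (nx ∷ u) sub with ∈-∃++ (sub (here refl))
... | ys , zs , refl = begin
  suc (length xs)              ≤⟨ s≤s (Unique-⊆-length u sub′) ⟩
  suc (length (ys ++ zs))      ≡⟨ cong suc (length-++ ys) ⟩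
  suc (length ys + length zs)  ≡⟨ +-suc _ _ ⟨
  length ys + suc (length zs)  ≡⟨ length-++ ys ⟨
  length (ys ++ x ∷ zs)        ∎
  where
  open ≤-Reasoning
  sub′ : ∀ {y} → y ∈ xs → y ∈ ys ++ zs
  sub′ y∈ with ∈-++⁻ ys (sub (there y∈))
  ... | inj₁ y∈ys         = ∈-++⁺ˡ y∈ys
  ... | inj₂ (here refl)  = ⊥-elim (All.lookup nx y∈ refl)
  ... | inj₂ (there y∈zs) = ∈-++⁺ʳ ys y∈zs

words-product : ∀ n k → words n (suc k) ≡ cartesianProductWith _∷_ (range n) (words n k)
words-product n k = go (range n)
  where
  go : ∀ is → concatMap (λ i → map (i ∷_) (words n k)) is ≡ cartesianProductWith _∷_ is (words n k)
  go []       = refl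
  go (i ∷ is) = cong (map (i ∷_) (words n k) ++_) (go is)

words-unique : ∀ n k → Unique (words n k)
words-unique n zero    = [] ∷ []
words-unique n (suc k) rewrite words-product n k =
  Unique.cartesianProductWith⁺ _∷_ ∷-injective (Unique.map⁺ suc-injective (Unique.upTo⁺ n)) (words-unique n k)

∈-words⁺ : ∀ n {w} → All (_∈ range n) w → w ∈ words n (length w)
∈-words⁺ n []             = here refl
∈-words⁺ n {x ∷ w} (p ∷ ps) rewrite words-product n (length w) =
  ∈-cartesianProductWith⁺ _∷_ p (∈-words⁺ n ps)

∈-words⁻ : ∀ n k {w} → w ∈ words n k → length w ≡ k
∈-words⁻ n zero (here refl) = refl
∈-words⁻ n (suc k) w∈ rewrite words-product n k
  with ∈-cartesianProductWith⁻ _∷_ (range n) (words n k) w∈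
... | _ , _ , _ , w∈′ , refl = cong suc (∈-words⁻ n k w∈′)

∉⇒elemᵇ : ∀ x xs → All (x ≢_) xs → elemᵇ x xs ≡ false
∉⇒elemᵇ x []       []       = refl
∉⇒elemᵇ x (y ∷ xs) (p ∷ ps) with x ≡ᵇ y in eq
... | true  = ⊥-elim (p (≡ᵇ⇒≡ x y (from T-≡ eq)))
... | false = ∉⇒elemᵇ x xs ps

elemᵇ⇒∉ : ∀ x xs → elemᵇ x xs ≡ false → All (x ≢_) xs
elemᵇ⇒∉ x []       e = []
elemᵇ⇒∉ x (y ∷ xs) e with x ≡ᵇ y in eq
... | false = (λ x≡y → true≢false (to T-≡ (≡⇒≡ᵇ x y x≡y)) eq) ∷ elemᵇ⇒∉ x xs e

Unique⇒distinct : ∀ {xs} → Unique xs → distinct xs ≡ true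
Unique⇒distinct []                = refl
Unique⇒distinct {x ∷ xs} (p ∷ ps) rewrite ∉⇒elemᵇ x xs p = Unique⇒distinct ps

distinct⇒Unique : ∀ xs → distinct xs ≡ true → Unique xs
distinct⇒Unique []       d = []
distinct⇒Unique (x ∷ xs) d with elemᵇ x xs in eq
... | false = elemᵇ⇒∉ x xs eq ∷ distinct⇒Unique xs d

eqList⇒≡ : ∀ xs ys → eqList xs ys ≡ true → xs ≡ ys
eqList⇒≡ []       []       e = refl
eqList⇒≡ (x ∷ xs) (y ∷ ys) e with x ≡ᵇ y in eq
... | true = cong₂ _∷_ (≡ᵇ⇒≡ x y (from T-≡ eq)) (eqList⇒≡ xs ys e)

eqList-refl : ∀ xs → eqList xs xs ≡ true
eqList-refl []       = refl
eqList-refl (x ∷ xs) rewrite to T-≡ (≡⇒≡ᵇ x x refl) = eqList-refl xs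

S-unique : ∀ n → Unique (S n)
S-unique n = Unique.filter⁺ (T? ∘ distinct) (words-unique n n)

∈-S⁻ : ∀ n {w} → w ∈ S n → length w ≡ n × Unique w
∈-S⁻ n {w} w∈ = let w∈words , d = ∈-filter⁻ (T? ∘ distinct) {xs = words n n} w∈ in
  ∈-words⁻ n n w∈words , distinct⇒Unique w (to T-≡ d)

∈-S⁺ : ∀ n {w} → w ↭ range n → w ∈ S n
∈-S⁺ n {w} w↭ = ∈-filter⁺ (T? ∘ distinct)
  (subst (λ k → w ∈ words n k) length-w (∈-words⁺ n (All-resp-↭ (↭-sym w↭) (All.tabulate λ p → p))))
  (from T-≡ (Unique⇒distinct unique-w))
  where
  length-w : length w ≡ n
  length-w = trans (↭-length w↭) (trans (length-map suc (upTo n)) (length-upTo n))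
  unique-w : Unique w
  unique-w = Permutation.Unique-resp-↭ (setoid ℕ) (↭⇒↭ₛ (↭-sym w↭)) (Unique.map⁺ suc-injective (Unique.upTo⁺ n))

-- The default 0 appears only beyond the list, where the counts do not look.
nth : List ℕ → ℕ → ℕ
nth []       _       = 0
nth (x ∷ xs) zero    = x
nth (x ∷ xs) (suc i) = nth xs i

applyUpTo-nth : ∀ xs → applyUpTo (nth xs) (length xs) ≡ xs
applyUpTo-nth []       = refl
applyUpTo-nth (x ∷ xs) = cong (x ∷_) (applyUpTo-nth xs)

nth-∈ : ∀ xs i → i < length xs → nth xs i ∈ xs
nth-∈ (x ∷ xs) zero    _       = here refl
nth-∈ (x ∷ xs) (suc i) (s≤s p) = there (nth-∈ xs i p)

nth-distinct : ∀ xs → Unique xs → ∀ i j → i < j → j < length xs → nth xs i ≢ nth xs j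
nth-distinct (x ∷ xs) (p ∷ u) zero    (suc j) _         (s≤s j<) = All.lookup p (nth-∈ xs j j<)
nth-distinct (x ∷ xs) (p ∷ u) (suc i) (suc j) (s≤s i<j) (s≤s j<) = nth-distinct xs u i j i<j j<

foldr-⊔-≤ : ∀ {A : Set} (f : A → ℕ) b xs → (∀ {x} → x ∈ xs → f x ≤ b) → foldr _⊔_ 0 (map f xs) ≤ b
foldr-⊔-≤ f b []       h = z≤n
foldr-⊔-≤ f b (x ∷ xs) h = ⊔-lub (h (here refl)) (foldr-⊔-≤ f b xs (h ∘ there))

≤-foldr-⊔ : ∀ {A : Set} (f : A → ℕ) {x xs} → x ∈ xs → f x ≤ foldr _⊔_ 0 (map f xs)
≤-foldr-⊔ f (here refl)            = m≤m⊔n _ _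
≤-foldr-⊔ f {xs = _ ∷ xs} (there p) = ≤-trans (≤-foldr-⊔ f p) (m≤n⊔m _ _)

module Counting (σ : Triple) (_≺_ : ℕ → ℕ → Bool)
  (pattern-σ : ∀ a b c → sameOrder (a , b , c) σ ≡ not (a ≺ b) ∧ not (a ≺ c) ∧ (b ≺ c))
  (≺-trans  : ∀ {a b c} → (a ≺ b) ≡ true → (b ≺ c) ≡ true → (a ≺ c) ≡ true)
  (≺-cotrans : ∀ {a b c} → (a ≺ b) ≡ false → (b ≺ c) ≡ false → (a ≺ c) ≡ false)
  where

  open Machine σ _≺_ pattern-σ ≺-trans ≺-cotrans

  length-inputs : ∀ p m → length (inputs p m) ≤ central m
  length-inputs p zero    = ≤-refl
  length-inputs p (suc m) = subst (_≤ central (suc m)) (sym (length-candidates p (suc m) []))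
    (schemes≤central (letters p) (suc m))

  -- The first entry of a preimage lies at the bottom of the stack and leaves last, so it is `p m`;
  -- only the other `m` entries are free.
  preimageCount-≤ : ∀ m {π} → π ∈ S (suc m) → preimageCount σ (suc m) π ≤ central m
  preimageCount-≤ m {π} π∈ = begin
    length (filterᵇ preimage (S (suc m)))  ≤⟨ Unique-⊆-length (Unique.filter⁺ (T? ∘ preimage) (S-unique (suc m))) sub ⟩
    length (map (p m ∷_) (inputs p m))     ≡⟨ length-map _ (inputs p m) ⟩
    length (inputs p m)                    ≤⟨ length-inputs p m ⟩
    central m                              ∎
    where
    open ≤-Reasoning
    preimage = λ τ → eqList (SC σ τ) π
    p = nth π
    lenπ = proj₁ (∈-S⁻ (suc m) π∈)
    π≡ : π ≡ applyUpTo p m ++ [ p m ]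
    π≡ = trans (sym (applyUpTo-nth π)) (trans (cong (applyUpTo p) lenπ) (sym (applyUpTo-∷ʳ p m)))
    dist : Distinct p m
    dist i j i<j j≤m = nth-distinct π (proj₂ (∈-S⁻ (suc m) π∈)) i j i<j
      (subst (j <_) (sym lenπ) (s≤s j≤m))
    sub : ∀ {τ} → τ ∈ filterᵇ preimage (S (suc m)) → τ ∈ map (p m ∷_) (inputs p m)
    sub {τ} τ∈ with ∈-filter⁻ (T? ∘ preimage) {xs = S (suc m)} τ∈
    ... | τ∈S , e = go τ (proj₁ (∈-S⁻ (suc m) τ∈S)) (eqList⇒≡ (SC σ τ) π (to T-≡ e))
      where
      go : ∀ τ → length τ ≡ suc m → SC σ τ ≡ π → τ ∈ map (p m ∷_) (inputs p m)
      go (x ∷ xs) len sc with ∷ʳ-injective (proj₁ bottom) (applyUpTo p m) (trans (sym (proj₂ bottom)) (trans out π≡))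
        where
        bottom = stays xs [] x [] (λ _ → refl)
        out : process xs (x ∷ []) ≡ π
        out = trans (sym (run≡process xs (x ∷ []) refl)) sc
      ... | _ , refl = ∈-map⁺ _ (inputs-complete m m ≤-refl p xs [] dist (suc-injective len)
              (trans (sym (run≡process xs (x ∷ []) refl)) (trans sc π≡)))

  -- Preimages of the extremal permutation

  -- The second component makes the order strict, which `≺` itself is not for 132.
  _⊏_ : ℕ → ℕ → Set
  a ⊏ b = (a ≺ b) ≡ true × (b ≺ a) ≡ false

  -- The inputs that turn into as ++ reverse bs on a stack with top s, when as ≺ s ≺ bs:
  -- the runs of as between two entries of bs arrive reversed, and q is the part of the
  -- current run collected so far.
  merges : List ℕ → List ℕ → List ℕ → List (List ℕ)
  merges []       q []       = q ∷ []
  merges (a ∷ as) q []       = merges as (a ∷ q) []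
  merges []       q (b ∷ bs) = map (λ r → q ++ b ∷ r) (merges [] [] bs)
  merges (a ∷ as) q (b ∷ bs) =
    map (λ r → q ++ b ∷ r) (merges (a ∷ as) [] bs) ++ merges as (a ∷ q) (b ∷ bs)

  length-merges : ∀ as q bs → length (merges as q bs) ≡ (length as + length bs) C length as
  length-merges []       q []       = refl
  length-merges (a ∷ as) q []       = trans (length-merges as (a ∷ q) []) (trans (one (length as)) (sym (one (suc (length as)))))
    where
    one : ∀ n → (n + 0) C n ≡ 1
    one n rewrite +-identityʳ n = nCn≡1 n
  length-merges []       q (b ∷ bs) = trans (length-map _ (merges [] [] bs)) (length-merges [] [] bs)
  length-merges (a ∷ as) q (b ∷ bs) = begin
    length (map _ (merges (a ∷ as) [] bs) ++ merges as (a ∷ q) (b ∷ bs))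
      ≡⟨ length-++ (map _ (merges (a ∷ as) [] bs)) ⟩
    length (map _ (merges (a ∷ as) [] bs)) + length (merges as (a ∷ q) (b ∷ bs))
      ≡⟨ cong₂ _+_ (trans (length-map _ (merges (a ∷ as) [] bs)) (length-merges (a ∷ as) [] bs)) (length-merges as (a ∷ q) (b ∷ bs)) ⟩
    (suc i + j) C suc i + (i + suc j) C i  ≡⟨ +-comm ((suc i + j) C suc i) _ ⟩
    (i + suc j) C i + (suc i + j) C suc i  ≡⟨ cong (λ k → (i + suc j) C i + k C suc i) (+-suc i j) ⟨
    (i + suc j) C i + (i + suc j) C suc i  ≡⟨ pascal (i + suc j) i ⟨
    (suc i + suc j) C suc i                ∎
    where
    open ≡-Reasoning
    i = length as
    j = length bs

  sorted-dropˡ : ∀ R {Z} → AllPairs _⊏_ (R ++ Z) → AllPairs _⊏_ Z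
  sorted-dropˡ []      h       = h
  sorted-dropˡ (r ∷ R) (_ ∷ h) = sorted-dropˡ R h

  sorted-remove : ∀ as {s Z} → AllPairs _⊏_ (as ++ s ∷ Z) → AllPairs _⊏_ (as ++ Z)
  sorted-remove []       (_ ∷ h) = h
  sorted-remove (a ∷ as) (p ∷ h) =
    All.++⁺ (All.++⁻ˡ as p) (All.tail (All.++⁻ʳ as p)) ∷ sorted-remove as h

  sorted-chain : ∀ R {s Z} → AllPairs _⊏_ (R ++ s ∷ Z) → Chain s R
  sorted-chain []           _                     = []
  sorted-chain (r ∷ [])     ((p ∷ _) ∷ h)         = proj₁ p ∷ []
  sorted-chain (r ∷ r′ ∷ R) ((p ∷ _) ∷ h)         = proj₁ p ∷ sorted-chain (r′ ∷ R) h

  chain-suffix : ∀ q {s R} → Chain s (q ʳ++ R) → Chain s R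
  chain-suffix []      c = c
  chain-suffix (a ∷ q) c with chain-suffix q c
  ... | _ ∷ c′ = c′

  push-all : ∀ q R s st rest → Chain s (q ʳ++ R) →
             process (q ++ rest) (R ++ s ∷ st) ≡ process rest ((q ʳ++ R) ++ s ∷ st)
  push-all []      R s st rest c = refl
  push-all (a ∷ q) R s st rest c with chain-suffix q c
  ... | a≺ ∷ _ = trans (process-below a (q ++ rest) R s st a≺) (push-all q (a ∷ R) s st rest c)

  -- The pop of the last entry of `R` also compares `b` with `s`; `safe` then stops the popping at
  -- `s`.
  pop-all : ∀ R b r s st → Chain s R → All (λ a → (b ≺ a) ≡ false) R → (b ≺ s) ≡ false →
            blocked b s st ≡ false →
            process (b ∷ r) (R ++ s ∷ st) ≡ R ++ process r (b ∷ s ∷ st)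
  pop-all []      b r s st c       ps       bs safe = process-push b r s st safe
  pop-all (a ∷ R) b r s st (h ∷ c) (p ∷ ps) bs safe =
    trans (process-pop b r a (R ++ s ∷ st) pop) (cong (a ∷_) (pop-all R b r s st c ps bs safe))
    where
    next : ∀ R → All (λ a → (b ≺ a) ≡ false) R → (b ≺ top s R) ≡ false
    next []      []      = bs
    next (_ ∷ _) (p ∷ _) = p
    pop : blocked b a (R ++ s ∷ st) ≡ true
    pop rewrite blocked-top b a R s st | p | next R ps = h

  Sound : List ℕ → List ℕ → List ℕ → ℕ → List ℕ → Set
  Sound as q bs s st = ∀ {x} → AllPairs _⊏_ (q ʳ++ (as ++ s ∷ bs)) →
    (∀ x → blocked x s st ≡ false) → x ∈ merges as q bs →
    process x (s ∷ st) ≡ q ʳ++ (as ++ (bs ʳ++ (s ∷ st)))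

  -- The run `q` piles up on `s` and is popped by `b`. As `b ⊀ s`, `b` is never popped early and
  -- takes over the role of `s`. The recursive call is passed in as `ih`.
  insert-sound : ∀ as q b bs s st {x} → AllPairs _⊏_ (q ʳ++ (as ++ s ∷ b ∷ bs)) →
    (∀ x → blocked x s st ≡ false) → Sound as [] bs b (s ∷ st) →
    x ∈ map (λ r → q ++ b ∷ r) (merges as [] bs) →
    process x (s ∷ st) ≡ q ʳ++ (as ++ ((b ∷ bs) ʳ++ (s ∷ st)))
  insert-sound as q b bs s st h safe ih x∈ with ∈-map⁻ _ x∈
  ... | r , r∈ , refl = begin
    process (q ++ b ∷ r) (s ∷ st)       ≡⟨ push-all q [] s st (b ∷ r) chain ⟩
    process (b ∷ r) (R ++ s ∷ st)       ≡⟨ pop-all R b r s st chain above b≮s (safe b) ⟩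
    R ++ process r (b ∷ s ∷ st)         ≡⟨ cong (R ++_) (ih rest (blocked-no-ascent b s st b≮s) r∈) ⟩
    R ++ (as ++ (bs ʳ++ (b ∷ s ∷ st)))  ≡⟨ ʳ++-++ q ⟩
    q ʳ++ (as ++ (bs ʳ++ (b ∷ s ∷ st))) ∎
    where
    open ≡-Reasoning
    R = q ʳ++ []
    h′ : AllPairs _⊏_ (R ++ as ++ s ∷ b ∷ bs)
    h′ = subst (AllPairs _⊏_) (sym (ʳ++-++ q)) h
    drop-as : ∀ as {Z} → AllPairs _⊏_ (R ++ as ++ Z) → AllPairs _⊏_ (R ++ Z)
    drop-as []       h = h
    drop-as (a ∷ as) h = drop-as as (sorted-remove R h)
    hR : AllPairs _⊏_ (R ++ s ∷ b ∷ bs)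
    hR = drop-as as h′
    chain : Chain s R
    chain = sorted-chain R hR
    before : ∀ R {b Z} → AllPairs _⊏_ (R ++ b ∷ Z) → All (λ a → (b ≺ a) ≡ false) R
    before []      _       = []
    before (r ∷ R) (p ∷ h) = proj₂ (All.head (All.++⁻ʳ R p)) ∷ before R h
    above : All (λ a → (b ≺ a) ≡ false) R
    above = before R (sorted-remove R hR)
    b≮s : (b ≺ s) ≡ false
    b≮s with sorted-dropˡ R hR
    ... | (p ∷ _) ∷ _ = proj₂ p
    rest : AllPairs _⊏_ (as ++ b ∷ bs)
    rest = sorted-remove as (sorted-dropˡ R h′)

  merges-sound : ∀ as q bs s st → Sound as q bs s st
  merges-sound [] q [] s st h safe (here refl) =
    trans (cong (λ z → process z (s ∷ st)) (sym (++-identityʳ q)))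
      (trans (push-all q [] s st [] (sorted-chain (q ʳ++ []) (subst (AllPairs _⊏_) (sym (ʳ++-++ q)) h)))
        (ʳ++-++ q))
  merges-sound (a ∷ as) q []       s st h safe x∈ = merges-sound as (a ∷ q) [] s st h safe x∈
  merges-sound []       q (b ∷ bs) s st h safe x∈ =
    insert-sound [] q b bs s st h safe (merges-sound [] [] bs b (s ∷ st)) x∈
  merges-sound (a ∷ as) q (b ∷ bs) s st h safe x∈ =
    [ insert-sound (a ∷ as) q b bs s st h safe (merges-sound (a ∷ as) [] bs b (s ∷ st))
    , merges-sound as (a ∷ q) (b ∷ bs) s st h safe
    ]′ (∈-++⁻ (map (λ r → q ++ b ∷ r) (merges (a ∷ as) [] bs)) x∈)

  -- The position of the first `b` tells the two alternatives of `merges` apart: `length q` in one,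
  -- larger in the other.
  merges-prefix : ∀ as q b bs {x} → All (b ≢_) as → All (b ≢_) q → x ∈ merges as q (b ∷ bs) →
    ∃ λ g → ∃ λ r → x ≡ g ++ b ∷ r × All (b ≢_) g × length q ≤ length g
  merges-prefix [] q b bs ha hq x∈ with ∈-map⁻ _ x∈
  ... | r , _ , refl = q , r , refl , hq , ≤-refl
  merges-prefix (a ∷ as) q b bs (a≢ ∷ ha) hq x∈
    with ∈-++⁻ (map (λ r → q ++ b ∷ r) (merges (a ∷ as) [] bs)) x∈
  ... | inj₁ l with ∈-map⁻ _ l
  ...   | r , _ , refl = q , r , refl , hq , ≤-refl
  merges-prefix (a ∷ as) q b bs (a≢ ∷ ha) hq x∈ | inj₂ x∈′
    with merges-prefix as (a ∷ q) b bs ha (a≢ ∷ hq) x∈′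
  ... | g , r , e , hg , le = g , r , e , hg , ≤-trans (n≤1+n _) le

  first-occurrence : ∀ g g′ {b : ℕ} {r r′} → All (b ≢_) g → All (b ≢_) g′ →
    g ++ b ∷ r ≡ g′ ++ b ∷ r′ → length g ≡ length g′
  first-occurrence []      []        _       _       e = refl
  first-occurrence []      (x ∷ g′)  _       (p ∷ _) e = ⊥-elim (p (∷-injectiveˡ e))
  first-occurrence (x ∷ g) []        (p ∷ _) _       e = ⊥-elim (p (sym (∷-injectiveˡ e)))
  first-occurrence (x ∷ g) (x′ ∷ g′) (_ ∷ h) (_ ∷ h′) e =
    cong suc (first-occurrence g g′ h h′ (∷-injectiveʳ e))

  merges-unique : ∀ as q bs → All (λ b → All (b ≢_) as) bs → All (λ b → All (b ≢_) q) bs →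
                  Unique (merges as q bs)
  merges-unique []       q []       _  _  = [] ∷ []
  merges-unique (a ∷ as) q []       _  _  = merges-unique as (a ∷ q) [] [] []
  merges-unique []       q (b ∷ bs) (_ ∷ ha) _ =
    Unique.map⁺ (λ e → ∷-injectiveʳ (++-cancelˡ q _ _ e))
      (merges-unique [] [] bs ha (All.map (λ _ → []) ha))
  merges-unique (a ∷ as) q (b ∷ bs) (hb ∷ ha) (hq ∷ hqs) = Unique.++⁺
    (Unique.map⁺ (λ e → ∷-injectiveʳ (++-cancelˡ q _ _ e))
      (merges-unique (a ∷ as) [] bs ha (All.map (λ _ → []) ha)))
    (merges-unique as (a ∷ q) (b ∷ bs) (All.map All.tail (hb ∷ ha))
      (All.zipWith (λ (p , q) → All.head p ∷ q) (hb ∷ ha , hq ∷ hqs)))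
    disjoint
    where
    disjoint : ∀ {x} → ¬ (x ∈ map (λ r → q ++ b ∷ r) (merges (a ∷ as) [] bs) × x ∈ merges as (a ∷ q) (b ∷ bs))
    disjoint (l , r) with ∈-map⁻ _ l | merges-prefix as (a ∷ q) b bs (All.tail hb) (All.head hb ∷ hq) r
    ... | _ , _ , e | g , _ , e′ , hg , lt =
      <-irrefl (first-occurrence q g hq hg (trans (sym e) e′)) lt

  process-↭ : ∀ xs st → process xs st ↭ xs ++ st
  process-↭ []       st       = ↭-refl
  process-↭ (x ∷ xs) []       = ↭-trans (process-↭ xs (x ∷ [])) (shift x xs [])
  process-↭ (x ∷ xs) (s ∷ st) = if-elim (_↭ x ∷ xs ++ s ∷ st) (blocked x s st)
    (λ _ → ↭-trans (prep s (process-↭ (x ∷ xs) st)) (↭-sym (shift s (x ∷ xs) st)))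
    (λ _ → ↭-trans (process-↭ xs (x ∷ s ∷ st)) (shift x xs (s ∷ st)))

  -- `s` enters first and leaves last, so every merge placed after `s` is a preimage of `π`;
  -- `process-↭` shows that it is a permutation.
  central-≤-preimageCount : ∀ n as s bs → AllPairs _⊏_ (as ++ s ∷ bs) → as ++ s ∷ bs ↭ range n →
    ∃ λ π → π ∈ S n × (length as + length bs) C length as ≤ preimageCount σ n π
  central-≤-preimageCount n as s bs sorted perm = π , ∈-S⁺ n π↭ , (begin
    (length as + length bs) C length as  ≡⟨ length-merges as [] bs ⟨
    length (merges as [] bs)             ≡⟨ length-map _ (merges as [] bs) ⟨
    length (map (s ∷_) (merges as [] bs)) ≤⟨ Unique-⊆-length (Unique.map⁺ ∷-injectiveʳ (merges-unique as [] bs apart (All.map (λ _ → []) apart))) sub ⟩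
    preimageCount σ n π                  ∎)
    where
    open ≤-Reasoning
    π = as ++ (bs ʳ++ (s ∷ []))
    π↭ : π ↭ range n
    π↭ = ↭-trans (++⁺ˡ as (↭-reverse (s ∷ bs))) perm
    sub : ∀ {τ} → τ ∈ map (s ∷_) (merges as [] bs) → τ ∈ filterᵇ (λ τ → eqList (SC σ τ) π) (S n)
    sub {τ} τ∈ with ∈-map⁻ _ τ∈
    ... | x , x∈ , refl = ∈-filter⁺ (T? ∘ λ τ → eqList (SC σ τ) π)
      (∈-S⁺ n (↭-trans (∷↭∷ʳ s x) (↭-trans (↭-sym (process-↭ x (s ∷ []))) (↭-trans (↭-reflexive sound) π↭))))
      (from T-≡ (trans (cong (λ z → eqList z π) (trans (run≡process x (s ∷ []) refl) sound)) (eqList-refl π)))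
      where
      sound : process x (s ∷ []) ≡ π
      sound = merges-sound as [] bs s [] sorted (λ _ → refl) x∈
    differ : ∀ {a b} → a ⊏ b → b ≢ a
    differ (t , f) refl = true≢false t f
    apart : All (λ b → All (b ≢_) as) bs
    apart = All.tabulate λ b∈ → lookups as (sorted-remove as sorted) b∈
      where
      lookups : ∀ as {b} → AllPairs _⊏_ (as ++ bs) → b ∈ bs → All (b ≢_) as
      lookups []       _       _  = []
      lookups (a ∷ as) (p ∷ h) b∈ = differ (All.lookup (All.++⁻ʳ as p) b∈) ∷ lookups as h b∈

  maxPreimage≡central : ∀ m cs → AllPairs _⊏_ cs → cs ↭ range (suc m) →
                        maxPreimage σ (suc m) ≡ central m
  maxPreimage≡central m cs sorted perm = ≤-antisym
    (foldr-⊔-≤ (preimageCount σ (suc m)) (central m) (S (suc m)) (preimageCount-≤ m))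
    (lower (drop k cs) (length-drop k cs) (take++drop≡id k cs))
    where
    k = m / 2
    k≤m : k ≤ m
    k≤m = ≤-trans (m≤m+n k k) (half+half≤ m)
    length-cs : length cs ≡ suc m
    length-cs = trans (↭-length perm) (trans (length-map suc (upTo (suc m))) (length-upTo (suc m)))
    length-as : length (take k cs) ≡ k
    length-as = trans (length-take k cs) (m≤n⇒m⊓n≡m (≤-trans k≤m (≤-trans (n≤1+n m) (≤-reflexive (sym length-cs)))))
    lower : ∀ rest → length rest ≡ length cs ∸ k → take k cs ++ rest ≡ cs →
            central m ≤ maxPreimage σ (suc m)
    -- Since `k ≤ m`, dropping `k` of the `suc m` entries leaves at least one, which becomes `s`.
    lower rest len eq with trans len (trans (cong (_∸ k) length-cs) (+-∸-assoc 1 k≤m))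
    lower (s ∷ bs) len eq | len′
      with central-≤-preimageCount (suc m) (take k cs) s bs
             (subst (AllPairs _⊏_) (sym eq) sorted) (↭-trans (↭-reflexive eq) perm)
    ... | π , π∈ , le = ≤-trans (≤-reflexive (sym (cong₂ _C_ total length-as)))
            (≤-trans le (≤-foldr-⊔ (preimageCount σ (suc m)) π∈))
      where
      total : length (take k cs) + length bs ≡ m
      total = trans (cong₂ _+_ length-as (suc-injective len′)) (m+[n∸m]≡n k≤m)

-- The orders for 312 and 132

range-reversed : ∀ n → map suc (downFrom n) ↭ range n
range-reversed n = ↭-trans (↭-reflexive eq) (↭-reverse (range n))
  where
  eq : map suc (downFrom n) ≡ reverse (range n)
  eq = trans (cong (map suc) (sym (reverse-applyUpTo (λ i → i) n))) (map-ʳ++ suc (upTo n))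

<ᵇ-true : ∀ {a b} → a < b → (a <ᵇ b) ≡ true
<ᵇ-true lt = to T-≡ (<⇒<ᵇ lt)

<ᵇ-false : ∀ {a b} → b ≤ a → (a <ᵇ b) ≡ false
<ᵇ-false {a} {b} le with a <ᵇ b in eq
... | true  = ⊥-elim (<⇒≱ (<ᵇ⇒< a b (from T-≡ eq)) le)
... | false = refl

true-<ᵇ : ∀ a b → (a <ᵇ b) ≡ true → a < b
true-<ᵇ a b e = <ᵇ⇒< a b (from T-≡ e)

false-<ᵇ : ∀ a b → (a <ᵇ b) ≡ false → b ≤ a
false-<ᵇ a b e = ≮⇒≥ λ lt → true≢false (<ᵇ-true lt) e

-- 132 is the complement of 312.  The order is non-strict because sameOrder tests only
-- _<ᵇ_, so that this negation makes pattern132 exact without distinctness.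
_≥ᵇ_ : ℕ → ℕ → Bool
a ≥ᵇ b = not (a <ᵇ b)

not-true : ∀ {b} → not b ≡ true → b ≡ false
not-true {false} _ = refl

not-false : ∀ {b} → not b ≡ false → b ≡ true
not-false {true} _ = refl

pattern312 : ∀ a b c → sameOrder (a , b , c) pat312 ≡ not (a <ᵇ b) ∧ not (a <ᵇ c) ∧ (b <ᵇ c)
pattern312 a b c with a <ᵇ b | a <ᵇ c
... | true  | _     = refl
... | false | true  = refl
... | false | false with b <ᵇ c
...   | true  = refl
...   | false = refl

pattern132 : ∀ a b c → sameOrder (a , b , c) pat132 ≡ not (a ≥ᵇ b) ∧ not (a ≥ᵇ c) ∧ (b ≥ᵇ c)
pattern132 a b c with a <ᵇ b | a <ᵇ c
... | false | _     = refl
... | true  | false = refl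
... | true  | true  with b <ᵇ c
...   | true  = refl
...   | false = refl

module C312 = Counting pat312 _<ᵇ_ pattern312
  (λ {a} {b} {c} p q → <ᵇ-true (<-trans (true-<ᵇ a b p) (true-<ᵇ b c q)))
  (λ {a} {b} {c} p q → <ᵇ-false (≤-trans (false-<ᵇ b c q) (false-<ᵇ a b p)))

module C132 = Counting pat132 _≥ᵇ_ pattern132
  (λ {a} {b} {c} p q → cong not (<ᵇ-false (≤-trans (false-<ᵇ b c (not-true q)) (false-<ᵇ a b (not-true p)))))
  (λ {a} {b} {c} p q → cong not (<ᵇ-true (<-trans (true-<ᵇ a b (not-false p)) (true-<ᵇ b c (not-false q)))))

theorem4p11 : (n : ℕ) → 1 ≤ n →
    (maxPreimage pat132 n ≡ (n ∸ 1) C ((n ∸ 1) / 2))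
    × (maxPreimage pat312 n ≡ (n ∸ 1) C ((n ∸ 1) / 2))
theorem4p11 (suc m) _ =
  -- Sorted under `_≥ᵇ_` means decreasing, hence `downFrom`.
  C132.maxPreimage≡central m (map suc (downFrom (suc m)))
    (AllPairs.map⁺ (AllPairs.applyDownFrom⁺₁ (λ i → i) (suc m) λ j<i _ →
      cong not (<ᵇ-false (s≤s (<⇒≤ j<i))) , cong not (<ᵇ-true (s≤s j<i))))
    (range-reversed (suc m)) ,
  C312.maxPreimage≡central m (range (suc m))
    (AllPairs.map⁺ (AllPairs.applyUpTo⁺₁ (λ i → i) (suc m) λ i<j _ →
      <ᵇ-true (s≤s i<j) , <ᵇ-false (s≤s (<⇒≤ i<j))))
    ↭-refl
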